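{- Let $\alpha\ge 1$ be a parameter and let $G$ be a simple graph with $n$ vertices, $m$ edges, and minimum degree $\delta>\omega(\max\{\alpha\log n,\alpha k\})$. Then $G$ can be contracted into a multigraph $\overline G$ such that: (1) if the minimum $k$-cut of $G$ has size at most $\alpha\delta$, then every nontrivial minimum $k$-cut of $G$ is preserved in $\overline G$, i.e., no edge of such a cut is contracted in $\overline G$; (2) $\overline G$ has $\tilde O(\alpha m/\delta)$ edges and $\tilde O(\alpha m/\delta^2)$ vertices.
   Context: A $k$-cut of a graph $G=(V,E)$ is a partition $S_1,\ldots,S_k$ of $V$ into $k$ nonempty parts; its edge set consists of edges with endpoints in different parts, and its size is the number of such edges. A minimum $k$-cut $S^*_1,\ldots,S^*_k$ is nontrivial if no part $S^*_i$ has size $1$. Contracting two vertices $u,v$ replaces them by a single new vertex $x$; every edge with an endpoint in $\{u,v\}$ and the other endpoint outside becomes incident to $x$ (keeping its identity), edges between $u$ and $v$ are deleted, and all other edges are unchanged; thus the result may be a multigraph, and an edge of $G$ "is contracted" if it is deleted in this way at some step. $\tilde O(\cdot)$ hides polylogarithmic factors.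
   Formalization: The parameter α ≥ 1 is taken to be rational rather than real; the real case follows by replacing α with a slightly larger rational. -}

module Defs where

open import Data.Nat using (ℕ; zero; suc; _+_; _*_; _^_; _<ᵇ_; _≤_)
open import Data.Nat.Logarithm using (⌊log₂_⌋)
open import Data.Bool using (Bool; true; false; _∧_; not; if_then_else_)
open import Data.Fin using (Fin; toℕ; _≟_)
open import Data.Product using (Σ; ∃; _×_; _,_)
open import Relation.Binary.PropositionalEquality using (_≡_; _≢_)
open import Relation.Nullary using (¬_)
open import Relation.Nullary.Decidable using (⌊_⌋)
open import Function.Definitions using (Surjective)
open import Data.Integer using (+_)
open import Data.Rational using (ℚ; _/_)

record SimpleGraph (n : ℕ) : Set where
  field
    adj    : Fin n → Fin n → Bool
    sym    : ∀ u v → adj u v ≡ adj v u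
    irrefl : ∀ v → adj v v ≡ false
open SimpleGraph public

count : ∀ {n} → (Fin n → Bool) → ℕ
count {zero}  P = 0
count {suc n} P = (if P Fin.zero then 1 else 0) + count {n} (λ i → P (Fin.suc i))

sumF : ∀ {n} → (Fin n → ℕ) → ℕ
sumF {zero}  f = 0
sumF {suc n} f = f Fin.zero + sumF (λ i → f (Fin.suc i))

degree : ∀ {n} → SimpleGraph n → Fin n → ℕ
degree G v = count (adj G v)

IsMinDegree : ∀ {n} → SimpleGraph n → ℕ → Set
IsMinDegree G δ = (∀ v → δ ≤ degree G v) × (∃ λ v → degree G v ≡ δ)

edgesWhere : ∀ {n} → SimpleGraph n → (Fin n → Fin n → Bool) → ℕ
edgesWhere G P = sumF (λ u → count (λ v → (toℕ u <ᵇ toℕ v) ∧ adj G u v ∧ P u v))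

numEdges : ∀ {n} → SimpleGraph n → ℕ
numEdges G = edgesWhere G (λ _ _ → true)

record KCut {n} (k : ℕ) (G : SimpleGraph n) : Set where
  field
    part     : Fin n → Fin k
    nonempty : Surjective _≡_ _≡_ part
open KCut public

crossing : ∀ {n k} {G : SimpleGraph n} → KCut k G → Fin n → Fin n → Bool
crossing S u v = not ⌊ part S u ≟ part S v ⌋

cutSize : ∀ {n k} {G : SimpleGraph n} → KCut k G → ℕ
cutSize {G = G} S = edgesWhere G (crossing S)

IsMinKCut : ∀ {n k} (G : SimpleGraph n) → KCut k G → Set
IsMinKCut {k = k} G S = ∀ (T : KCut k G) → cutSize S ≤ cutSize T

Nontrivial : ∀ {n k} {G : SimpleGraph n} → KCut k G → Set
Nontrivial S = ∀ i → ¬ (count (λ v → ⌊ part S v ≟ i ⌋) ≡ 1)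

-- Contractions.
-- The result of any sequence of contractions of vertex pairs of G is
-- determined by the map sending each vertex of G to the vertex of the
-- contracted multigraph it was merged into; this map is surjective and
-- conversely every surjection arises this way.  Edges keep their identity:
-- an edge {u,v} of G is contracted iff u and v are merged (f u ≡ f v);
-- otherwise it survives as an edge of the multigraph between f u and f v.
record Contraction {n} (G : SimpleGraph n) : Set where
  field
    size  : ℕ
    merge : Fin n → Fin size
    onto  : Surjective _≡_ _≡_ merge
open Contraction public

surviving : ∀ {n} {G : SimpleGraph n} → Contraction G → Fin n → Fin n → Bool
surviving C u v = not ⌊ merge C u ≟ merge C v ⌋

contractedEdges : ∀ {n} {G : SimpleGraph n} → Contraction G → ℕ
contractedEdges {G = G} C = edgesWhere G (surviving C)

Preserves : ∀ {n k} {G : SimpleGraph n} → Contraction G → KCut k G → Set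
Preserves {n} {G = G} C S =
  ∀ (u v : Fin n) → adj G u v ≡ true → part S u ≢ part S v → merge C u ≢ merge C v

ℕ→ℚ : ℕ → ℚ
ℕ→ℚ n = + n / 1

logℕ : ℕ → ℕ
logℕ n = ⌊log₂ n ⌋

{-# OPTIONS --safe #-}
-- Start from the trivial partition of the vertices. As long as some k-cut of size at most αδ
-- leaves more than δ/10 vertices of some class outside every single part, refine all classes by it.
-- Each refinement separates at most αδ further edges, and more than δ/10 vertices
-- see the size of their class halved; hence at most O(α n log n) = O(α m log n / δ) edges run
-- between the final classes. Call a vertex a core vertex if at most a third of its
-- edges leave its class, and contract the core of every class. Non-core vertices have total
-- degree O(α m log n / δ), and a class with a core vertex has at least 2δ/3 vertices, which bounds
-- the edges and the vertices. If a nontrivial minimum k-cut separated two core vertices of a class,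
-- then one of them would lie outside the part containing all but δ/10 of that class, and moving it
-- there would give a smaller k-cut.
module Submission where

open import Defs renaming (sym to adj-sym)
open import Data.Nat using (ℕ; zero; suc; _+_; _^_; _<ᵇ_)
open import Data.Product using (Σ; ∃; _×_; _,_)

module _ where
  open import Data.Bool using (Bool; true; false; _∧_; _∨_; not; if_then_else_; T)
  open import Data.Bool.Properties using (T-∧; T-∨; T-≡)
  open import Data.Empty using (⊥; ⊥-elim)
  open import Data.Fin using (Fin; zero; suc; toℕ; _≟_; finToFun; funToFin)
  open import Data.List using (List; []; _∷_)
  open import Data.List.Properties using (∷-injectiveˡ; ∷-injectiveʳ) renaming (≡-dec to List-≡-dec)
  open import Data.Fin.Properties using (any?; all?; ¬∀⟶∃¬; toℕ-injective; finToFun-funToFin)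
  import Data.Fin.Properties as Finₚ
  open import Data.Nat using (_*_; _≤_; _<_; z≤n; s≤s; >-nonZero)
  open import Data.Nat.Logarithm using (⌊log₂_⌋; ⌊log₂⌋-mono-≤; ⌊log₂[2*b]⌋≡1+⌊log₂b⌋)
  open import Data.Nat.Properties hiding (_≟_)
  open import Data.Product using (proj₁; proj₂)
  open import Data.Sum using (_⊎_; inj₁; inj₂)
  open import Data.Sum.Properties using (inj₁-injective; inj₂-injective) renaming (≡-dec to ⊎-≡-dec)
  open import Data.Unit using (tt)
  open import Data.Vec.Functional using (updateAt)
  open import Data.Vec.Functional.Properties using (updateAt-updates; updateAt-minimal)
  open import Function.Definitions using (Surjective)
  open import Function using (_∘_; const; Equivalence)
  open import Relation.Binary.PropositionalEquality
    using (_≡_; _≢_; refl; sym; trans; cong; cong₂; subst; module ≡-Reasoning)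
  open import Relation.Binary.Definitions using (DecidableEquality)
  open import Relation.Nullary using (¬_; Dec; yes; no)
  open import Relation.Nullary.Decidable using (⌊_⌋; toWitness; fromWitness; toWitnessFalse; fromWitnessFalse; _×-dec_; ¬?)
  open import Data.Nat.Tactic.RingSolver using (solve-∀)

  open Equivalence using (to; from)

  ≢ᵇ-sym : ∀ {A : Set} (_≟ᴬ_ : DecidableEquality A) x y → not ⌊ x ≟ᴬ y ⌋ ≡ not ⌊ y ≟ᴬ x ⌋
  ≢ᵇ-sym _≟ᴬ_ x y with x ≟ᴬ y | y ≟ᴬ x
  ... | yes _ | yes _ = refl
  ... | no  _ | no  _ = refl
  ... | yes e | no ¬e = ⊥-elim (¬e (sym e))
  ... | no ¬e | yes e = ⊥-elim (¬e (sym e))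

  -- Sums and counts

  ind : Bool → ℕ
  ind b = if b then 1 else 0

  ind≤1 : ∀ b → ind b ≤ 1
  ind≤1 false = z≤n
  ind≤1 true  = ≤-refl

  sumF-mono : ∀ {n} {f g : Fin n → ℕ} → (∀ i → f i ≤ g i) → sumF f ≤ sumF g
  sumF-mono {zero}  f≤g = z≤n
  sumF-mono {suc n} f≤g = +-mono-≤ (f≤g zero) (sumF-mono (f≤g ∘ suc))

  sumF-cong : ∀ {n} {f g : Fin n → ℕ} → (∀ i → f i ≡ g i) → sumF f ≡ sumF g
  sumF-cong {zero}  f≡g = refl
  sumF-cong {suc n} f≡g = cong₂ _+_ (f≡g zero) (sumF-cong (f≡g ∘ suc))

  sumF-+ : ∀ {n} (f g : Fin n → ℕ) → sumF (λ i → f i + g i) ≡ sumF f + sumF g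
  sumF-+ {zero}  f g = refl
  sumF-+ {suc n} f g = trans (cong (f zero + g zero +_) (sumF-+ (f ∘ suc) (g ∘ suc)))
    (interchange (f zero) (g zero) (sumF (f ∘ suc)) (sumF (g ∘ suc)))
    where
    interchange : ∀ a b c d → a + b + (c + d) ≡ a + c + (b + d)
    interchange = solve-∀

  sumF-* : ∀ {n} c (f : Fin n → ℕ) → sumF (λ i → c * f i) ≡ c * sumF f
  sumF-* {zero}  c f = sym (*-zeroʳ c)
  sumF-* {suc n} c f = trans (cong (c * f zero +_) (sumF-* c (f ∘ suc)))
    (sym (*-distribˡ-+ c (f zero) (sumF (f ∘ suc))))

  sumF-const : ∀ n c → sumF {n} (const c) ≡ n * c
  sumF-const zero    c = refl
  sumF-const (suc n) c = cong (c +_) (sumF-const n c)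

  sumF-0 : ∀ n → sumF {n} (const 0) ≡ 0
  sumF-0 n = trans (sumF-const n 0) (*-zeroʳ n)

  sumF-swap : ∀ {m n} (f : Fin m → Fin n → ℕ) →
    sumF (λ i → sumF (f i)) ≡ sumF (λ j → sumF (λ i → f i j))
  sumF-swap {zero}  {n} f = sym (sumF-0 n)
  sumF-swap {suc m} {n} f = trans (cong (sumF (f zero) +_) (sumF-swap (f ∘ suc)))
    (sym (sumF-+ (f zero) (λ j → sumF (λ i → f (suc i) j))))

  sumF-single : ∀ {n} (u : Fin n) (f : Fin n → ℕ) →
    sumF (λ x → if ⌊ x ≟ u ⌋ then f x else 0) ≡ f u
  sumF-single {suc n} zero    f = trans (cong (f zero +_) (sumF-0 n)) (+-identityʳ (f zero))
  sumF-single {suc n} (suc u) f = trans (sumF-cong drop-suc) (sumF-single u (f ∘ suc))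
    where
    drop-suc : ∀ x → (if ⌊ suc x ≟ suc u ⌋ then f (suc x) else 0)
                   ≡ (if ⌊ x ≟ u ⌋ then f (suc x) else 0)
    drop-suc x with x ≟ u
    ... | yes _ = refl
    ... | no  _ = refl

  sumF-unique : ∀ {n} (e : Fin n → Bool) c → (∀ i j → T (e i) → T (e j) → i ≡ j) →
    sumF (λ i → if e i then c else 0) ≤ c
  sumF-unique {zero}  e c uniq = z≤n
  sumF-unique {suc n} e c uniq with e zero in eq
  ... | false = sumF-unique (e ∘ suc) c
                  λ i j p q → Finₚ.suc-injective (uniq (suc i) (suc j) p q)
  ... | true  = ≤-reflexive (trans (cong (c +_) (trans (sumF-cong rest) (sumF-0 n))) (+-identityʳ c))
    where
    rest : ∀ i → (if e (suc i) then c else 0) ≡ 0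
    rest i with e (suc i) in eq′
    ... | false = refl
    ... | true with () ← uniq zero (suc i) (from T-≡ eq) (from T-≡ eq′)

  -- After exchanging the two sums, each `v` is charged to at most one `i`. This pays for all
  -- representatives of the contracted graph at once.
  sumF-disjoint : ∀ {m n} (M : Fin m → Fin n → Bool) (w : Fin n → ℕ) →
    (∀ i j v → T (M i v) → T (M j v) → i ≡ j) →
    sumF (λ i → sumF (λ v → if M i v then w v else 0)) ≤ sumF w
  sumF-disjoint M w disj = ≤-trans
    (≤-reflexive (sumF-swap (λ i v → if M i v then w v else 0)))
    (sumF-mono λ v → sumF-unique (λ i → M i v) (w v) (λ i j → disj i j v))

  count-ind : ∀ {n} (P : Fin n → Bool) → count P ≡ sumF (ind ∘ P)
  count-ind {zero}  P = refl
  count-ind {suc n} P = cong (ind (P zero) +_) (count-ind (P ∘ suc))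

  ind-mono : ∀ p q → (T p → T q) → ind p ≤ ind q
  ind-mono false q     h = z≤n
  ind-mono true  false h = ⊥-elim (h tt)
  ind-mono true  true  h = ≤-refl

  ind-∪ : ∀ p q r → (T p → T q ⊎ T r) → ind p ≤ ind q + ind r
  ind-∪ false q     r     h = z≤n
  ind-∪ true  true  r     h = s≤s z≤n
  ind-∪ true  false true  h = s≤s z≤n
  ind-∪ true  false false h with h tt
  ... | inj₁ ()
  ... | inj₂ ()

  ind-⊎ : ∀ p q r → (T p → T r) → (T q → T r) → (T p → T q → ⊥) → ind p + ind q ≤ ind r
  ind-⊎ false q     r p⊆r q⊆r disj = ind-mono q r q⊆r
  ind-⊎ true  false r p⊆r q⊆r disj = ind-mono true r p⊆r
  ind-⊎ true  true  r p⊆r q⊆r disj = ⊥-elim (disj tt tt)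

  module _ {n : ℕ} {P Q : Fin n → Bool} where
    count-mono : (∀ i → T (P i) → T (Q i)) → count P ≤ count Q
    count-mono P⊆Q rewrite count-ind P | count-ind Q = sumF-mono λ i → ind-mono (P i) (Q i) (P⊆Q i)

    count-∪ : {R : Fin n → Bool} → (∀ i → T (P i) → T (Q i) ⊎ T (R i)) →
      count P ≤ count Q + count R
    count-∪ {R} P⊆Q∪R rewrite count-ind P | count-ind Q | count-ind R = ≤-trans
      (sumF-mono λ i → ind-∪ (P i) (Q i) (R i) (P⊆Q∪R i))
      (≤-reflexive (sumF-+ (ind ∘ Q) (ind ∘ R)))

    count-⊎ : {R : Fin n → Bool} → (∀ i → T (P i) → T (R i)) → (∀ i → T (Q i) → T (R i)) →
      (∀ i → T (P i) → T (Q i) → ⊥) → count P + count Q ≤ count R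
    count-⊎ {R} P⊆R Q⊆R disj rewrite count-ind P | count-ind Q | count-ind R = ≤-trans
      (≤-reflexive (sym (sumF-+ (ind ∘ P) (ind ∘ Q))))
      (sumF-mono λ i → ind-⊎ (P i) (Q i) (R i) (P⊆R i) (Q⊆R i) (disj i))

  count-all : ∀ n → count {n} (const true) ≡ n
  count-all zero    = refl
  count-all (suc n) = cong suc (count-all n)

  count-none : ∀ {n} {P : Fin n → Bool} → (∀ i → ¬ T (P i)) → count P ≡ 0
  count-none {zero}      ¬P = refl
  count-none {suc n} {P} ¬P with P zero | ¬P zero
  ... | false | _  = count-none (¬P ∘ suc)
  ... | true  | ¬⊤ = ⊥-elim (¬⊤ tt)

  count-≡1 : ∀ {n} (P : Fin n → Bool) u → T (P u) → (∀ v → T (P v) → v ≡ u) → count P ≡ 1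
  count-≡1 P u Pu only = begin
    count P                                       ≡⟨ count-ind P ⟩
    sumF (ind ∘ P)                                ≡⟨ sumF-cong pointwise ⟩
    sumF (λ x → if ⌊ x ≟ u ⌋ then 1 else 0)       ≡⟨ sumF-single u (const 1) ⟩
    1                                             ∎
    where
    open ≡-Reasoning
    pointwise : ∀ x → ind (P x) ≡ (if ⌊ x ≟ u ⌋ then 1 else 0)
    pointwise x with x ≟ u
    ... | yes refl = cong ind (to T-≡ Pu)
    ... | no  x≢u with P x in eq
    ...   | false = refl
    ...   | true  = ⊥-elim (x≢u (only x (from T-≡ eq)))

  count-pos : ∀ {n} {P : Fin n → Bool} u → T (P u) → 1 ≤ count P
  count-pos {P = P} u Pu = subst (_≤ count P) (count-≡1 (λ x → ⌊ x ≟ u ⌋) u (fromWitness {a? = u ≟ u} refl) (λ v → toWitness))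
    (count-mono {P = λ x → ⌊ x ≟ u ⌋} λ v v≡u → subst (T ∘ P) (sym (toWitness {a? = v ≟ u} v≡u)) Pu)

  -- Ordered pairs versus edges

  pairs : ∀ {n} → (Fin n → Fin n → Bool) → ℕ
  pairs e = sumF (λ u → count (e u))

  pairs-ind : ∀ {n} (e : Fin n → Fin n → Bool) → pairs e ≡ sumF (λ u → sumF (λ v → ind (e u v)))
  pairs-ind e = sumF-cong (λ u → count-ind (e u))

  -- Symmetry and the absence of loops split the ordered pairs into u < v and v < u; exchanging the
  -- sums identifies the two halves.
  handshake : ∀ {n} (e : Fin n → Fin n → Bool) →
    (∀ u v → e u v ≡ e v u) → (∀ v → e v v ≡ false) →
    pairs e ≡ 2 * pairs (λ u v → (toℕ u <ᵇ toℕ v) ∧ e u v)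
  handshake e e-sym e-irr = begin
    pairs e                                       ≡⟨ pairs-ind e ⟩
    sumF (λ u → sumF (λ v → ind (e u v)))         ≡⟨ sumF-cong (λ u → trans (sumF-cong (split u)) (sumF-+ (up u) (λ v → up v u))) ⟩
    sumF (λ u → sumF (up u) + sumF (λ v → up v u)) ≡⟨ sumF-+ (λ u → sumF (up u)) (λ u → sumF (λ v → up v u)) ⟩
    U + sumF (λ u → sumF (λ v → up v u))          ≡⟨ cong (U +_) (sumF-swap up) ⟨
    U + U                                         ≡⟨ cong (U +_) (+-identityʳ U) ⟨
    2 * U                                         ≡⟨ cong (2 *_) (pairs-ind (λ u v → (toℕ u <ᵇ toℕ v) ∧ e u v)) ⟨
    2 * pairs (λ u v → (toℕ u <ᵇ toℕ v) ∧ e u v)  ∎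
    where
    open ≡-Reasoning
    up : _ → _ → ℕ
    up u v = ind ((toℕ u <ᵇ toℕ v) ∧ e u v)
    U : ℕ
    U = sumF (λ u → sumF (up u))
    split : ∀ u v → ind (e u v) ≡ up u v + up v u
    split u v with toℕ u <ᵇ toℕ v in uv | toℕ v <ᵇ toℕ u in vu
    ... | true  | true  = ⊥-elim (<-asym (<ᵇ⇒< (toℕ u) (toℕ v) (from T-≡ uv)) (<ᵇ⇒< (toℕ v) (toℕ u) (from T-≡ vu)))
    ... | true  | false = sym (+-identityʳ _)
    ... | false | true  = cong ind (e-sym u v)
    ... | false | false with refl ← toℕ-injective {i = u} {j = v} (≤-antisym
              (≮⇒≥ (λ v<u → subst T vu (<⇒<ᵇ v<u))) (≮⇒≥ (λ u<v → subst T uv (<⇒<ᵇ u<v)))) = cong ind (e-irr u)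

  module _ {n : ℕ} (G : SimpleGraph n) where
    adjAnd : (Fin n → Fin n → Bool) → Fin n → Fin n → Bool
    adjAnd P u v = adj G u v ∧ P u v

    pairs≡2edges : ∀ {P} → (∀ u v → P u v ≡ P v u) → pairs (adjAnd P) ≡ 2 * edgesWhere G P
    pairs≡2edges P-sym = handshake (adjAnd _)
      (λ u v → cong₂ _∧_ (adj-sym G u v) (P-sym u v))
      (λ v → cong (_∧ _) (irrefl G v))

    edgesWhere-∪ : ∀ {P Q R} → (∀ u v → T (P u v) → T (Q u v) ⊎ T (R u v)) →
      edgesWhere G P ≤ edgesWhere G Q + edgesWhere G R
    edgesWhere-∪ {P} {Q} {R} P⊆Q∪R = ≤-trans
      (sumF-mono λ u → count-∪ (λ v → guard (toℕ u <ᵇ toℕ v) (adj G u v) (P⊆Q∪R u v)))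
      (≤-reflexive (sumF-+ (λ u → count (λ v → (toℕ u <ᵇ toℕ v) ∧ adj G u v ∧ Q u v))
                           (λ u → count (λ v → (toℕ u <ᵇ toℕ v) ∧ adj G u v ∧ R u v))))
      where
      guard : ∀ s t {p q r} → (T p → T q ⊎ T r) → T (s ∧ t ∧ p) → T (s ∧ t ∧ q) ⊎ T (s ∧ t ∧ r)
      guard true true h = h

    -- The degree sum is 2m. This turns bounds in terms of n into bounds in terms of m/δ.
    minDegree-sum : ∀ {δ} → (∀ v → δ ≤ degree G v) → n * δ ≤ 2 * numEdges G
    minDegree-sum {δ} δ≤ = begin
      n * δ                          ≡⟨ sumF-const n δ ⟨
      sumF {n} (const δ)             ≤⟨ sumF-mono δ≤ ⟩
      sumF (degree G)                ≤⟨ sumF-mono (λ u → count-mono {P = adj G u} {adjAnd (λ _ _ → true) u} λ v a → from T-∧ (a , tt)) ⟩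
      pairs (adjAnd (λ _ _ → true))  ≡⟨ pairs≡2edges (λ _ _ → refl) ⟩
      2 * numEdges G                 ∎
      where open ≤-Reasoning

  -- Doubling adds exactly one to the floored logarithm, but only for positive arguments, since
  -- `⌊log₂ 0 ⌋` is 0.
  1+log≤log : ∀ {x y} → 1 ≤ x → 2 * x ≤ y → 1 + ⌊log₂ x ⌋ ≤ ⌊log₂ y ⌋
  1+log≤log {x} 1≤x 2x≤y = subst (_≤ _) (⌊log₂[2*b]⌋≡1+⌊log₂b⌋ x {{>-nonZero 1≤x}}) (⌊log₂⌋-mono-≤ 2x≤y)

  -- Successive refinement by cuts

  -- This is `crossing` for a map that need not be onto, so it applies to every enumerated map and
  -- to a map altered at one vertex.
  cross : ∀ {n k} → (Fin n → Fin k) → Fin n → Fin n → Bool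
  cross p u v = not ⌊ p u ≟ p v ⌋

  infix 4 _≟ᴸ_
  _≟ᴸ_ : ∀ {k} (xs ys : List (Fin k)) → Dec (xs ≡ ys)
  _≟ᴸ_ = List-≡-dec _≟_

  module _ {n k : ℕ} where
    -- A partition of the vertices: the list of a vertex records its part in every cut used so far,
    -- and equal lists mean the same class.
    Labelling : Set
    Labelling = Fin n → List (Fin k)

    same apart : Labelling → Fin n → Fin n → Bool
    same  ℓ u v = ⌊ ℓ u ≟ᴸ ℓ v ⌋
    apart ℓ u v = not (same ℓ u v)

    classSize : Labelling → List (Fin k) → ℕ
    classSize ℓ x = count (λ v → ⌊ x ≟ᴸ ℓ v ⌋)

    -- An entropy: up to rounding, the sum of |C| log |C| over the classes C. Halving the class of a
    -- vertex costs it one unit.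
    potential : Labelling → ℕ
    potential ℓ = sumF (λ v → ⌊log₂ classSize ℓ (ℓ v) ⌋)

    outliers : (Fin n → Fin k) → Labelling → Fin n → Fin k → ℕ
    outliers p ℓ a i = count (λ v → same ℓ a v ∧ not ⌊ p v ≟ i ⌋)

    NearlyConstant : ℕ → (Fin n → Fin k) → Labelling → Set
    NearlyConstant δ p ℓ = ∀ a → ∃ λ i → 10 * outliers p ℓ a i ≤ δ

    nearlyConstant? : ∀ δ p ℓ → Dec (NearlyConstant δ p ℓ)
    nearlyConstant? δ p ℓ = all? λ a → any? λ i → 10 * outliers p ℓ a i ≤? δ

    refine : (Fin n → Fin k) → Labelling → Labelling
    refine p ℓ v = p v ∷ ℓ v

    -- Classes only shrink under refinement, so outlier counts cannot grow. Hence a cut once dealt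
    -- with stays dealt with, and a single pass over all cuts suffices.
    refine-nearlyConstant : ∀ {δ} p {q} ℓ → NearlyConstant δ q ℓ → NearlyConstant δ q (refine p ℓ)
    refine-nearlyConstant p {q} ℓ near a with near a
    ... | i , le = i , ≤-trans (*-monoʳ-≤ 10 (count-mono λ v h → from T-∧ (shrink v (to T-∧ h)))) le
      where
      shrink : ∀ v → T (same (refine p ℓ) a v) × T (not ⌊ q v ≟ i ⌋) → T (same ℓ a v) × T (not ⌊ q v ≟ i ⌋)
      shrink v (s , o) = fromWitness {a? = ℓ a ≟ᴸ ℓ v} (∷-injectiveʳ (toWitness {a? = refine p ℓ a ≟ᴸ refine p ℓ v} s)) , o

    refine-self : ∀ {δ} p ℓ → NearlyConstant δ p (refine p ℓ)
    refine-self {δ} p ℓ a = p a , subst (λ c → 10 * c ≤ δ) (sym (count-none none)) z≤n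
      where
      none : ∀ v → ¬ T (same (refine p ℓ) a v ∧ not ⌊ p v ≟ p a ⌋)
      none v h with s , o ← to T-∧ h = toWitnessFalse {a? = p v ≟ p a} o
        (sym (∷-injectiveˡ (toWitness {a? = refine p ℓ a ≟ᴸ refine p ℓ v} s)))

    module _ (p : Fin n → Fin k) (ℓ : Labelling) where
      private
        ℓ′ : Labelling
        ℓ′ = refine p ℓ
        s s′ : Fin n → ℕ
        s  v = classSize ℓ (ℓ v)
        s′ v = classSize ℓ′ (ℓ′ v)
        Halved : Fin n → Set
        Halved v = 2 * s′ v ≤ s v
        halved? : ∀ v → Dec (Halved v)
        halved? v = 2 * s′ v ≤? s v

        ℓ′⊆ℓ : ∀ u v → T (same ℓ′ u v) → T (same ℓ u v)
        ℓ′⊆ℓ u v h = fromWitness {a? = ℓ u ≟ᴸ ℓ v} (∷-injectiveʳ (toWitness {a? = ℓ′ u ≟ᴸ ℓ′ v} h))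

        classes-disjoint : ∀ u v → ℓ u ≡ ℓ v → p u ≢ p v → s′ u + s′ v ≤ s u
        classes-disjoint u v ℓu≡ℓv pu≢pv = count-⊎ (ℓ′⊆ℓ u)
          (λ w h → subst (λ x → T ⌊ x ≟ᴸ ℓ w ⌋) (sym ℓu≡ℓv) (ℓ′⊆ℓ v w h))
          (λ w h h′ → pu≢pv (trans (∷-injectiveˡ (toWitness {a? = ℓ′ u ≟ᴸ ℓ′ w} h))
                                    (sym (∷-injectiveˡ (toWitness {a? = ℓ′ v ≟ᴸ ℓ′ w} h′)))))

        -- Two subclasses of one class cannot both contain more than half of it.
        halved-outside-one-part : ∀ a → ∃ λ i → ∀ v → ℓ a ≡ ℓ v → p v ≢ i → Halved v
        -- The exceptional part is that of a vertex whose class is not halved. If there is no such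
        -- vertex, any part will do, and `p a` serves as default.
        halved-outside-one-part a with any? (λ w → (ℓ a ≟ᴸ ℓ w) ×-dec ¬? (halved? w))
        ... | no none = p a , λ v ℓa≡ℓv _ → case-halved v ℓa≡ℓv
          where
          case-halved : ∀ v → ℓ a ≡ ℓ v → Halved v
          case-halved v ℓa≡ℓv with halved? v
          ... | yes h = h
          ... | no ¬h = ⊥-elim (none (v , ℓa≡ℓv , ¬h))
        ... | yes (w , ℓa≡ℓw , ¬hw) = p w , outside
          where
          outside : ∀ v → ℓ a ≡ ℓ v → p v ≢ p w → Halved v
          outside v ℓa≡ℓv pv≢pw with halved? v
          ... | yes h = h
          ... | no ¬hv = ⊥-elim (<-irrefl refl (begin-strict
            s v + s v           ≡⟨ cong (λ x → s v + classSize ℓ x) (trans (sym ℓa≡ℓv) ℓa≡ℓw) ⟩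
            s v + s w           <⟨ +-mono-< (≰⇒> ¬hv) (≰⇒> ¬hw) ⟩
            2 * s′ v + 2 * s′ w ≡⟨ *-distribˡ-+ 2 (s′ v) (s′ w) ⟨
            2 * (s′ v + s′ w)   ≤⟨ *-monoʳ-≤ 2 (classes-disjoint v w (trans (sym ℓa≡ℓv) ℓa≡ℓw) pv≢pw) ⟩
            2 * s v             ≡⟨ cong (s v +_) (+-identityʳ (s v)) ⟩
            s v + s v           ∎))
            where open ≤-Reasoning

        -- A subclass is no larger than its class, and a halved one loses a whole unit of logarithm;
        -- the new class is nonempty because it contains `v`.
        log-drop : ∀ v → ⌊log₂ s′ v ⌋ + ind ⌊ halved? v ⌋ ≤ ⌊log₂ s v ⌋
        log-drop v with halved? v
        ... | yes h = ≤-trans (≤-reflexive (+-comm _ 1))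
                        (1+log≤log (count-pos v (fromWitness {a? = ℓ′ v ≟ᴸ ℓ′ v} refl)) h)
        ... | no  _ = ≤-trans (≤-reflexive (+-identityʳ _)) (⌊log₂⌋-mono-≤ (count-mono (ℓ′⊆ℓ v)))

      -- `L` is the number of halved vertices. Failure of near constancy yields a class in which
      -- every part leaves out more than δ/10 vertices. Applied to the exceptional part of that
      -- class, this gives more than δ/10 outliers, all of them halved.
      potential-drop : ∀ {δ} → ¬ NearlyConstant δ p ℓ →
        ∃ λ L → δ ≤ 10 * L × potential ℓ′ + L ≤ potential ℓ
      potential-drop {δ} ¬near
        with a , ¬i ← ¬∀⟶∃¬ n (λ a → ∃ λ i → 10 * outliers p ℓ a i ≤ δ)
                         (λ a → any? λ i → 10 * outliers p ℓ a i ≤? δ) ¬near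
        with i , outside ← halved-outside-one-part a =
          count (λ v → ⌊ halved? v ⌋)
        , ≤-trans (<⇒≤ (≰⇒> (λ le → ¬i (i , le)))) (*-monoʳ-≤ 10 (count-mono outlier⇒halved))
        , (begin
            potential ℓ′ + count (λ v → ⌊ halved? v ⌋)
              ≡⟨ cong (potential ℓ′ +_) (count-ind (λ v → ⌊ halved? v ⌋)) ⟩
            potential ℓ′ + sumF (λ v → ind ⌊ halved? v ⌋)
              ≡⟨ sumF-+ (λ v → ⌊log₂ s′ v ⌋) (λ v → ind ⌊ halved? v ⌋) ⟨
            sumF (λ v → ⌊log₂ s′ v ⌋ + ind ⌊ halved? v ⌋)
              ≤⟨ sumF-mono log-drop ⟩
            potential ℓ ∎)
        where
        open ≤-Reasoning
        outlier⇒halved : ∀ v → T (same ℓ a v ∧ not ⌊ p v ≟ i ⌋) → T ⌊ halved? v ⌋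
        outlier⇒halved v h with s , o ← to T-∧ h =
          fromWitness {a? = halved? v} (outside v (toWitness {a? = ℓ a ≟ᴸ ℓ v} s) (toWitnessFalse {a? = p v ≟ i} o))

  module _ {n k : ℕ} (G : SimpleGraph n) where
    refine-edges : ∀ (p : Fin n → Fin k) ℓ →
      edgesWhere G (apart (refine p ℓ)) ≤ edgesWhere G (apart ℓ) + edgesWhere G (cross p)
    refine-edges p ℓ = edgesWhere-∪ G {apart (refine p ℓ)} {apart ℓ} {cross p} split
      where
      split : ∀ u v → T (apart (refine p ℓ) u v) → T (apart ℓ u v) ⊎ T (cross p u v)
      split u v h with ℓ u ≟ᴸ ℓ v | p u ≟ p v
      ... | no  _ | _     = inj₁ tt
      ... | yes _ | no  _ = inj₂ tt
      ... | yes _ | yes _ = ⊥-elim h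

    -- Every cut that is used for a refinement costs at most a·δ/b edges, and lowers
    -- the potential by δ/10; the weights 10a and b balance the two.
    refine-by-light-cuts : ∀ a b δ m (ps : Fin m → Fin n → Fin k) → ∃ λ (ℓ : Labelling) →
      (b * edgesWhere G (apart ℓ) + 10 * a * potential ℓ ≤ 10 * a * (n * logℕ n)) ×
      (∀ j → b * edgesWhere G (cross (ps j)) ≤ a * δ → NearlyConstant δ (ps j) ℓ)
    -- The empty list everywhere means a single class: no edge is apart, and the potential is
    -- exactly n log n.
    refine-by-light-cuts a b δ zero ps = const [] , ≤-reflexive eq , λ ()
      where
      open ≡-Reasoning
      no-edges : edgesWhere G (apart {n} {k} (const [])) ≡ 0
      no-edges = trans (sumF-cong λ u → count-none λ v → none (toℕ u <ᵇ toℕ v) (adj G u v)) (sumF-0 n)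
        where
        none : ∀ s t → ¬ T (s ∧ t ∧ false)
        none true true ()
        none true false ()
        none false _ ()
      eq : b * edgesWhere G (apart {n} {k} (const [])) + 10 * a * potential {n} {k} (const []) ≡ 10 * a * (n * logℕ n)
      eq = begin
        b * edgesWhere G (apart {n} {k} (const [])) + 10 * a * potential {n} {k} (const [])
          ≡⟨ cong₂ _+_ (trans (cong (b *_) no-edges) (*-zeroʳ b)) (cong (10 * a *_) (sumF-const n _)) ⟩
        10 * a * (n * ⌊log₂ count {n} (const true) ⌋)
          ≡⟨ cong (λ c → 10 * a * (n * ⌊log₂ c ⌋)) (count-all n) ⟩
        10 * a * (n * logℕ n) ∎
    -- The other cuts are treated first; a later refinement by `ps zero` keeps them nearly constant.
    refine-by-light-cuts a b δ (suc m) ps = extend (refine-by-light-cuts a b δ m (ps ∘ suc))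
      where
      open ≤-Reasoning
      p : Fin n → Fin k
      p = ps zero
      Y : ℕ
      Y = edgesWhere G (cross p)
      regroup₁ : ∀ a L → a * (10 * L) ≡ 10 * a * L
      regroup₁ = solve-∀
      regroup₂ : ∀ x y z w → x + y * z + y * w ≡ x + y * (w + z)
      regroup₂ = solve-∀
      step : ∀ ℓ L → b * Y ≤ a * δ → δ ≤ 10 * L → potential (refine p ℓ) + L ≤ potential ℓ →
        b * edgesWhere G (apart (refine p ℓ)) + 10 * a * potential (refine p ℓ)
          ≤ b * edgesWhere G (apart ℓ) + 10 * a * potential ℓ
      step ℓ L light δ≤10L drop = begin
        b * edgesWhere G (apart (refine p ℓ)) + 10 * a * Φ′ ≤⟨ +-monoˡ-≤ _ (*-monoʳ-≤ b (refine-edges p ℓ)) ⟩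
        b * (X + Y) + 10 * a * Φ′             ≡⟨ cong (_+ 10 * a * Φ′) (*-distribˡ-+ b X Y) ⟩
        b * X + b * Y + 10 * a * Φ′           ≤⟨ +-monoˡ-≤ _ (+-monoʳ-≤ (b * X) (≤-trans light (*-monoʳ-≤ a δ≤10L))) ⟩
        b * X + a * (10 * L) + 10 * a * Φ′    ≡⟨ cong (λ z → b * X + z + 10 * a * Φ′) (regroup₁ a L) ⟩
        b * X + 10 * a * L + 10 * a * Φ′      ≡⟨ regroup₂ (b * X) (10 * a) L Φ′ ⟩
        b * X + 10 * a * (Φ′ + L)             ≤⟨ +-monoʳ-≤ (b * X) (*-monoʳ-≤ (10 * a) drop) ⟩
        b * X + 10 * a * potential ℓ          ∎
        where
        X Φ′ : ℕ
        X  = edgesWhere G (apart ℓ)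
        Φ′ = potential (refine p ℓ)
      Refined : ∀ m → (Fin m → Fin n → Fin k) → Set
      Refined m ps = ∃ λ (ℓ : Labelling) →
        (b * edgesWhere G (apart ℓ) + 10 * a * potential ℓ ≤ 10 * a * (n * logℕ n)) ×
        (∀ j → b * edgesWhere G (cross (ps j)) ≤ a * δ → NearlyConstant δ (ps j) ℓ)
      decide : (r : Refined m (ps ∘ suc)) → Dec (b * Y ≤ a * δ) → Dec (NearlyConstant δ p (proj₁ r)) →
        Refined (suc m) ps
      decide (ℓ , inv , near) (no heavy)  _          = ℓ , inv , λ { zero h → ⊥-elim (heavy h) ; (suc j) → near j }
      decide (ℓ , inv , near) (yes _)     (yes good) = ℓ , inv , λ { zero _ → good ; (suc j) → near j }
      decide (ℓ , inv , near) (yes light) (no bad)   =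
        let L , δ≤10L , drop = potential-drop p ℓ bad in
          refine p ℓ , ≤-trans (step ℓ L light δ≤10L drop) inv
        , λ { zero _ → refine-self p ℓ ; (suc j) h → refine-nearlyConstant p ℓ (near j h) }
      extend : Refined m (ps ∘ suc) → Refined (suc m) ps
      extend r = decide r (b * Y ≤? a * δ) (nearlyConstant? δ p (proj₁ r))

  -- Moving one vertex to another part

  module _ {n k : ℕ} (G : SimpleGraph n) (p : Fin n → Fin k) (u : Fin n) (i : Fin k) where
    private
      p′ : Fin n → Fin k
      p′ = updateAt p u (const i)

      row : (Fin n → Fin k) → ℕ
      row q = count (adjAnd G (cross q) u)

      c : (Fin n → Fin k) → Fin n → Fin n → ℕ
      c q x y = ind (adjAnd G (cross q) x y)

      cross-sym : ∀ (q : Fin n → Fin k) x y → cross q x y ≡ cross q y x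
      cross-sym q x y = ≢ᵇ-sym _≟_ (q x) (q y)

      c-sym : ∀ q x y → c q x y ≡ c q y x
      c-sym q x y = cong ind (cong₂ _∧_ (adj-sym G x y) (cross-sym q x y))

      c-loop : ∀ q x → c q x x ≡ 0
      c-loop q x = cong (λ e → ind (e ∧ cross q x x)) (irrefl G x)

      c-unchanged : ∀ {x y} → x ≢ u → y ≢ u → c p′ x y ≡ c p x y
      c-unchanged {x} {y} x≢u y≢u = cong₂ (λ s t → ind (adj G x y ∧ not ⌊ s ≟ t ⌋))
        (updateAt-minimal x u p x≢u) (updateAt-minimal y u p y≢u)

      at : Fin n → ℕ → ℕ
      at x z = if ⌊ x ≟ u ⌋ then z else 0

      sum-at : ∀ (g : Fin n → ℕ) →
        sumF (λ x → sumF (λ y → at x (g y) + at y (g x))) ≡ 2 * sumF g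
      sum-at g = begin
        sumF (λ x → sumF (λ y → at x (g y) + at y (g x)))
          ≡⟨ sumF-cong (λ x → sumF-+ (λ y → at x (g y)) (λ y → at y (g x))) ⟩
        sumF (λ x → sumF (λ y → at x (g y)) + sumF (λ y → at y (g x)))
          ≡⟨ sumF-+ (λ x → sumF (λ y → at x (g y))) (λ x → sumF (λ y → at y (g x))) ⟩
        sumF (λ x → sumF (λ y → at x (g y))) + sumF (λ x → sumF (λ y → at y (g x)))
          ≡⟨ cong₂ _+_ (sumF-swap (λ x y → at x (g y))) (sumF-cong (λ x → sumF-single u (const (g x)))) ⟩
        sumF (λ y → sumF (λ x → at x (g y))) + sumF g
          ≡⟨ cong (_+ sumF g) (sumF-cong (λ y → sumF-single u (const (g y)))) ⟩
        sumF g + sumF g ≡⟨ cong (sumF g +_) (+-identityʳ (sumF g)) ⟨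
        2 * sumF g ∎
        where open ≡-Reasoning

      -- Pairs avoiding `u` look the same to both maps; in the row and column of `u` the two
      -- crossing indicators trade places. The pair (u, u) contributes nothing, as there are no
      -- loops.
      exchange : ∀ x y →
        c p′ x y + (at x (c p u y) + at y (c p u x)) ≡ c p x y + (at x (c p′ u y) + at y (c p′ u x))
      exchange x y with x ≟ u | y ≟ u
      ... | yes refl | yes refl rewrite c-loop p u | c-loop p′ u = refl
      ... | yes refl | no _     = swap₁ (c p′ u y) (c p u y)
        where
        swap₁ : ∀ s t → s + (t + 0) ≡ t + (s + 0)
        swap₁ = solve-∀
      ... | no _     | yes refl rewrite c-sym p x u | c-sym p′ x u = +-comm (c p′ u x) (c p u x)
      ... | no x≢u   | no y≢u   = cong (_+ 0) (c-unchanged x≢u y≢u)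

      -- Each crossing edge appears as two ordered pairs, and `g` is added once along the row and
      -- once along the column of `u`.
      total : ∀ q (g : Fin n → ℕ) →
        sumF (λ x → sumF (λ y → c q x y + (at x (g y) + at y (g x))))
          ≡ 2 * (edgesWhere G (cross q) + sumF g)
      total q g = begin
        sumF (λ x → sumF (λ y → c q x y + (at x (g y) + at y (g x))))
          ≡⟨ sumF-cong (λ x → sumF-+ (c q x) (λ y → at x (g y) + at y (g x))) ⟩
        sumF (λ x → sumF (c q x) + sumF (λ y → at x (g y) + at y (g x)))
          ≡⟨ sumF-+ (λ x → sumF (c q x)) (λ x → sumF (λ y → at x (g y) + at y (g x))) ⟩
        sumF (λ x → sumF (c q x)) + sumF (λ x → sumF (λ y → at x (g y) + at y (g x)))
          ≡⟨ cong₂ _+_ (trans (sym (pairs-ind (adjAnd G (cross q)))) (pairs≡2edges G (cross-sym q))) (sum-at g) ⟩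
        2 * edgesWhere G (cross q) + 2 * sumF g
          ≡⟨ *-distribˡ-+ 2 (edgesWhere G (cross q)) (sumF g) ⟨
        2 * (edgesWhere G (cross q) + sumF g) ∎
        where open ≡-Reasoning

    -- Only edges at `u` change status, so each side counts the crossing edges away from `u` plus
    -- both rows. The additive form avoids truncated subtraction.
    move-exchange : edgesWhere G (cross p′) + row p ≡ edgesWhere G (cross p) + row p′
    move-exchange = *-cancelˡ-≡ _ _ 2 (begin
      2 * (edgesWhere G (cross p′) + row p)
        ≡⟨ cong (λ r → 2 * (edgesWhere G (cross p′) + r)) (count-ind (adjAnd G (cross p) u)) ⟩
      2 * (edgesWhere G (cross p′) + sumF (c p u))
        ≡⟨ total p′ (c p u) ⟨
      sumF (λ x → sumF (λ y → c p′ x y + (at x (c p u y) + at y (c p u x))))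
        ≡⟨ sumF-cong (λ x → sumF-cong (exchange x)) ⟩
      sumF (λ x → sumF (λ y → c p x y + (at x (c p′ u y) + at y (c p′ u x))))
        ≡⟨ total p (c p′ u) ⟩
      2 * (edgesWhere G (cross p) + sumF (c p′ u))
        ≡⟨ cong (λ r → 2 * (edgesWhere G (cross p) + r)) (count-ind (adjAnd G (cross p′) u)) ⟨
      2 * (edgesWhere G (cross p) + row p′) ∎)
      where open ≡-Reasoning

    move-decreases : row p′ < row p → edgesWhere G (cross p′) < edgesWhere G (cross p)
    move-decreases lt = +-cancelʳ-< (row p) _ _ (begin-strict
      edgesWhere G (cross p′) + row p ≡⟨ move-exchange ⟩
      edgesWhere G (cross p) + row p′ <⟨ +-monoʳ-< (edgesWhere G (cross p)) lt ⟩
      edgesWhere G (cross p) + row p  ∎)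
      where open ≤-Reasoning

    -- The part that `u` leaves keeps another vertex because it is not a singleton; this is where
    -- nontriviality of the cut enters.
    move-surjective : Surjective _≡_ _≡_ p → ¬ (count (λ v → ⌊ p v ≟ p u ⌋) ≡ 1) → Surjective _≡_ _≡_ p′
    move-surjective onto-p not-alone j with p u ≟ j
    ... | no pu≢j with x , px≡j ← onto-p j =
      x , λ { refl → trans (updateAt-minimal x u p (λ { refl → pu≢j (px≡j refl) })) (px≡j refl) }
    ... | yes refl with any? (λ w → (p w ≟ p u) ×-dec ¬? (w ≟ u))
    ...   | yes (w , pw≡pu , w≢u) = w , λ { refl → trans (updateAt-minimal w u p w≢u) pw≡pu }
    ...   | no none = ⊥-elim (not-alone (count-≡1 _ u (fromWitness {a? = p u ≟ p u} refl) only))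
      where
      only : ∀ v → T ⌊ p v ≟ p u ⌋ → v ≡ u
      only v h with v ≟ u
      ... | yes v≡u = v≡u
      ... | no  v≢u = ⊥-elim (none (v , toWitness {a? = p v ≟ p u} h , v≢u))

  -- Cores of the classes

  module _ {n k : ℕ} (G : SimpleGraph n) (ℓ : Labelling {n} {k}) where
    outDegree : Fin n → ℕ
    outDegree v = count (adjAnd G (apart ℓ) v)

    Core : Fin n → Set
    Core v = 3 * outDegree v ≤ degree G v

    core? : ∀ v → Dec (Core v)
    core? v = 3 * outDegree v ≤? degree G v

    same-or-apart : ∀ u v → T (same ℓ u v) ⊎ T (apart ℓ u v)
    same-or-apart u v with same ℓ u v
    ... | true  = inj₁ tt
    ... | false = inj₂ tt

    apart-sym : ∀ u v → apart ℓ u v ≡ apart ℓ v u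
    apart-sym u v = ≢ᵇ-sym _≟ᴸ_ (ℓ u) (ℓ v)

    shavedDegree : Fin n → ℕ
    shavedDegree v = if ⌊ core? v ⌋ then 0 else degree G v

    -- A non-core vertex has degree below three times its out-degree, and the out-degrees sum to
    -- twice the number of edges between classes.
    sum-shavedDegree : sumF shavedDegree ≤ 6 * edgesWhere G (apart ℓ)
    sum-shavedDegree = begin
      sumF shavedDegree                    ≤⟨ sumF-mono pointwise ⟩
      sumF (λ v → 3 * outDegree v)         ≡⟨ sumF-* 3 outDegree ⟩
      3 * pairs (adjAnd G (apart ℓ))       ≡⟨ cong (3 *_) (pairs≡2edges G apart-sym) ⟩
      3 * (2 * edgesWhere G (apart ℓ))     ≡⟨ *-assoc 3 2 (edgesWhere G (apart ℓ)) ⟨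
      6 * edgesWhere G (apart ℓ)           ∎
      where
      open ≤-Reasoning
      pointwise : ∀ v → shavedDegree v ≤ 3 * outDegree v
      pointwise v with core? v
      ... | yes _ = z≤n
      ... | no ¬c = <⇒≤ (≰⇒> ¬c)

    -- At least two thirds of the neighbours of a core vertex lie in its class, and in a simple
    -- graph they are distinct vertices.
    core-class-large : ∀ {δ} v → δ ≤ degree G v → Core v → 2 * δ ≤ 3 * classSize ℓ (ℓ v)
    core-class-large {δ} v δ≤d core = ≤-trans (*-monoʳ-≤ 2 δ≤d) (+-cancelʳ-≤ d _ _ (begin
      2 * d + d                                     ≡⟨ arith₁ d ⟩
      3 * d                                         ≤⟨ *-monoʳ-≤ 3 covered ⟩
      3 * (classSize ℓ (ℓ v) + outDegree v)         ≡⟨ *-distribˡ-+ 3 (classSize ℓ (ℓ v)) (outDegree v) ⟩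
      3 * classSize ℓ (ℓ v) + 3 * outDegree v       ≤⟨ +-monoʳ-≤ (3 * classSize ℓ (ℓ v)) core ⟩
      3 * classSize ℓ (ℓ v) + d                     ∎))
      where
      open ≤-Reasoning
      d : ℕ
      d = degree G v
      arith₁ : ∀ d → 2 * d + d ≡ 3 * d
      arith₁ = solve-∀
      covered : d ≤ classSize ℓ (ℓ v) + outDegree v
      covered = count-∪ {P = adj G v} {same ℓ v} {adjAnd G (apart ℓ) v} side
        where
        side : ∀ w → T (adj G v w) → T (same ℓ v w) ⊎ T (adjAnd G (apart ℓ) v w)
        side w a with same-or-apart v w
        ... | inj₁ s = inj₁ s
        ... | inj₂ o = inj₂ (from T-∧ (a , o))

    -- Made empty for a non-core `u`, so that representatives of different contracted vertices own
    -- disjoint sets.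
    coreClass : Fin n → Fin n → Bool
    coreClass u v = ⌊ core? u ⌋ ∧ same ℓ u v

    -- A uniform charge of 2δ per vertex: a core vertex pays with its class, any other with its own
    -- degree.
    core-or-shaved : ∀ {δ} v → δ ≤ degree G v → 2 * δ ≤ 3 * count (coreClass v) + 2 * shavedDegree v
    core-or-shaved v δ≤d with core? v
    ... | yes c = ≤-trans (core-class-large v δ≤d c) (m≤m+n _ _)
    ... | no  _ = ≤-trans (*-monoʳ-≤ 2 δ≤d) (m≤n+m (2 * degree G v) (3 * count {n} (const false)))

    -- Let o be the out-degree of `u` and t the number of outliers. After the move, crossing
    -- neighbours are outside the class or outliers, at most o + t. Before it, all neighbours except
    -- these crossed, at least d - o - t. Since o ≤ d/3 and t ≤ d/10, the sum 2(o + t) is at most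
    -- 13d/15, less than d.
    core-prefers-majority : ∀ {δ} (p : Fin n → Fin k) u i → 0 < δ → δ ≤ degree G u →
      Core u → 10 * outliers p ℓ u i ≤ δ → p u ≢ i →
      count (adjAnd G (cross (updateAt p u (const i))) u) < count (adjAnd G (cross p) u)
    core-prefers-majority {δ} p u i 0<δ δ≤d core few pu≢i =
      ≰⇒> λ α≤β → <-irrefl refl (begin-strict
        -- The factor 15 clears the fractions: 30 o = 10 (3 o) and 30 t = 3 (10 t).
        13 * d                                <⟨ m<m+n (13 * d) (*-monoʳ-< 2 (≤-trans 0<δ δ≤d)) ⟩
        13 * d + 2 * d                        ≡⟨ arith₁ d ⟩
        15 * d                                ≤⟨ *-monoʳ-≤ 15 d≤ ⟩
        15 * (α + (t + o))                    ≤⟨ *-monoʳ-≤ 15 (+-monoˡ-≤ (t + o) (≤-trans α≤β β≤)) ⟩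
        15 * (o + t + (t + o))                ≡⟨ arith₂ o t ⟩
        10 * (3 * o) + 3 * (10 * t)           ≤⟨ +-mono-≤ (*-monoʳ-≤ 10 core) (*-monoʳ-≤ 3 (≤-trans few δ≤d)) ⟩
        10 * d + 3 * d                        ≡⟨ arith₃ d ⟩
        13 * d                                ∎)
      where
      open ≤-Reasoning
      p′ : Fin n → Fin k
      p′ = updateAt p u (const i)
      d o t α β : ℕ
      d = degree G u
      o = outDegree u
      t = outliers p ℓ u i
      α = count (adjAnd G (cross p) u)
      β = count (adjAnd G (cross p′) u)
      arith₁ : ∀ d → 13 * d + 2 * d ≡ 15 * d
      arith₁ = solve-∀
      arith₂ : ∀ o t → 15 * (o + t + (t + o)) ≡ 10 * (3 * o) + 3 * (10 * t)
      arith₂ = solve-∀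
      arith₃ : ∀ d → 10 * d + 3 * d ≡ 13 * d
      arith₃ = solve-∀
      Outlier : Fin n → Bool
      Outlier v = same ℓ u v ∧ not ⌊ p v ≟ i ⌋
      β≤ : β ≤ o + t
      β≤ = count-∪ {P = adjAnd G (cross p′) u} {adjAnd G (apart ℓ) u} {Outlier} side
        where
        side : ∀ v → T (adjAnd G (cross p′) u v) → T (adjAnd G (apart ℓ) u v) ⊎ T (Outlier v)
        side v h with a , x ← to T-∧ h | same-or-apart u v
        ... | inj₂ r = inj₁ (from T-∧ (a , r))
        ... | inj₁ s = inj₂ (from T-∧ (s , fromWitnessFalse {a? = p v ≟ i} λ pv≡i →
                toWitnessFalse {a? = p′ u ≟ p′ v} x
                  (trans (updateAt-updates u p) (sym (trans (updateAt-minimal v u p v≢u) pv≡i)))))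
          where
          v≢u : v ≢ u
          v≢u refl = subst T (irrefl G u) a
      d≤ : d ≤ α + (t + o)
      d≤ = ≤-trans (count-∪ {P = adj G u} {adjAnd G (cross p) u} {λ v → Outlier v ∨ adjAnd G (apart ℓ) u v} side)
        (+-monoʳ-≤ α (count-∪ {P = λ v → Outlier v ∨ adjAnd G (apart ℓ) u v} {Outlier} λ v → to T-∨))
        where
        side : ∀ v → T (adj G u v) → T (adjAnd G (cross p) u v) ⊎ T (Outlier v ∨ adjAnd G (apart ℓ) u v)
        side v a with same-or-apart u v | p v ≟ i
        ... | inj₂ r | _        = inj₂ (from T-∨ (inj₂ (from T-∧ (a , r))))
        ... | inj₁ s | no _     = inj₂ (from T-∨ (inj₁ (from T-∧ (s , tt))))
        ... | inj₁ s | yes refl = inj₁ (from T-∧ (a , fromWitnessFalse {a? = p u ≟ p v} pu≢i))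

    -- The vertices to be merged are those with equal keys: core vertices are keyed by their class,
    -- all others by themselves.
    key : Fin n → List (Fin k) ⊎ Fin n
    key v = if ⌊ core? v ⌋ then inj₁ (ℓ v) else inj₂ v

    key-≡ : ∀ u v → key u ≡ key v → u ≡ v ⊎ (Core u × Core v × ℓ u ≡ ℓ v)
    key-≡ u v eq with core? u | core? v
    ... | yes cu | yes cv = inj₂ (cu , cv , inj₁-injective eq)
    ... | no _   | no _   = inj₁ (inj₂-injective eq)
    key-≡ u v () | yes _ | no _
    key-≡ u v () | no _ | yes _

    core-key-≡ : ∀ {u v} → Core u → Core v → ℓ u ≡ ℓ v → key u ≡ key v
    core-key-≡ {u} {v} cu cv ℓ≡ with core? u | core? v
    ... | yes _  | yes _  = cong inj₁ ℓ≡
    ... | no ¬cu | _      = ⊥-elim (¬cu cu)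
    ... | yes _  | no ¬cv = ⊥-elim (¬cv cv)

  -- Quotients of finite sets by the fibres of a map

  quotient : ∀ {A : Set} → DecidableEquality A → ∀ {n} (f : Fin n → A) →
    ∃ λ s → Σ (Fin n → Fin s) λ e → Surjective _≡_ _≡_ e ×
      (∀ u v → e u ≡ e v → f u ≡ f v) × (∀ u v → f u ≡ f v → e u ≡ e v)
  quotient _≟ᴬ_ {zero}  f = 0 , (λ ()) , (λ ()) , (λ ()) , (λ ())
  quotient _≟ᴬ_ {suc n} f with s , e , onto-e , e⇒f , f⇒e ← quotient _≟ᴬ_ (f ∘ suc)
    -- The new point joins the fibre of some `w` with the same value or opens a fibre of its own.
    with any? (λ v → f zero ≟ᴬ f (suc v))
  ... | yes (w , f0≡fw) = s , e′
      , (λ y → suc (proj₁ (onto-e y)) , λ { refl → proj₂ (onto-e y) refl })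
      , (λ { zero    zero    _ → refl
           ; zero    (suc v) q → trans f0≡fw (e⇒f w v q)
           ; (suc u) zero    q → trans (e⇒f u w q) (sym f0≡fw)
           ; (suc u) (suc v) q → e⇒f u v q })
      , (λ { zero    zero    _ → refl
           ; zero    (suc v) q → f⇒e w v (trans (sym f0≡fw) q)
           ; (suc u) zero    q → f⇒e u w (trans q f0≡fw)
           ; (suc u) (suc v) q → f⇒e u v q })
    where
    e′ : Fin (suc n) → Fin s
    e′ zero    = e w
    e′ (suc v) = e v
  ... | no new = suc s , e′
      , (λ { zero → zero , λ { refl → refl }
           ; (suc y) → suc (proj₁ (onto-e y)) , λ { refl → cong suc (proj₂ (onto-e y) refl) } })
      , (λ { zero    zero    _ → refl
           ; (suc u) (suc v) q → e⇒f u v (Finₚ.suc-injective q) })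
      , (λ { zero    zero    _ → refl
           ; zero    (suc v) q → ⊥-elim (new (v , q))
           ; (suc u) zero    q → ⊥-elim (new (u , sym q))
           ; (suc u) (suc v) q → cong suc (f⇒e u v q) })
    where
    e′ : Fin (suc n) → Fin (suc s)
    e′ zero    = zero
    e′ (suc v) = suc (e v)

  -- The contraction of the cores: its edges, its vertices and the cuts it preserves

  module _ {n k : ℕ} (G : SimpleGraph n) (ℓ : Labelling {n} {k}) where
    private
      _≟ᴷ_ : DecidableEquality (List (Fin k) ⊎ Fin n)
      _≟ᴷ_ = ⊎-≡-dec _≟ᴸ_ _≟_

      N : ℕ
      N = edgesWhere G (apart ℓ)

    contractCores : Contraction G
    contractCores = let s , e , onto-e , _ = quotient _≟ᴷ_ (key G ℓ) in
      record { size = s ; merge = e ; onto = onto-e }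

    merged⇒key-≡ : ∀ u v → merge contractCores u ≡ merge contractCores v → key G ℓ u ≡ key G ℓ v
    merged⇒key-≡ = proj₁ (proj₂ (proj₂ (proj₂ (quotient _≟ᴷ_ (key G ℓ)))))

    key-≡⇒merged : ∀ u v → key G ℓ u ≡ key G ℓ v → merge contractCores u ≡ merge contractCores v
    key-≡⇒merged = proj₂ (proj₂ (proj₂ (proj₂ (quotient _≟ᴷ_ (key G ℓ)))))

    -- A surviving edge joins two classes or has a non-core endpoint. In ordered pairs the former
    -- contribute 2N and each of the two endpoints at most 6N, in all twice 7N.
    contractedEdges≤ : contractedEdges contractCores ≤ 7 * N
    contractedEdges≤ = *-cancelˡ-≤ 2 (begin
      2 * contractedEdges contractCores   ≡⟨ pairs≡2edges G surviving-sym ⟨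
      pairs (adjAnd G surv)               ≡⟨ pairs-ind (adjAnd G surv) ⟩
      sumF (λ u → sumF (λ v → ind (adjAnd G surv u v)))
        ≤⟨ sumF-mono (λ u → sumF-mono (pointwise u)) ⟩
      sumF (λ u → sumF (λ v → ind (adjAnd G (apart ℓ) u v) + (shaved u v + shaved v u)))
        ≡⟨ sumF-cong (λ u → trans (sumF-+ (λ v → ind (adjAnd G (apart ℓ) u v)) (λ v → shaved u v + shaved v u))
                                   (cong (sumF (λ v → ind (adjAnd G (apart ℓ) u v)) +_) (sumF-+ (shaved u) (λ v → shaved v u)))) ⟩
      sumF (λ u → sumF (λ v → ind (adjAnd G (apart ℓ) u v)) + (sumF (shaved u) + sumF (λ v → shaved v u)))
        ≡⟨ trans (sumF-+ (λ u → sumF (λ v → ind (adjAnd G (apart ℓ) u v))) (λ u → sumF (shaved u) + sumF (λ v → shaved v u)))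
                 (cong₂ _+_ (sym (pairs-ind (adjAnd G (apart ℓ)))) (sumF-+ (λ u → sumF (shaved u)) (λ u → sumF (λ v → shaved v u)))) ⟩
      pairs (adjAnd G (apart ℓ)) + (D + sumF (λ u → sumF (λ v → shaved v u)))
        ≡⟨ cong₂ (λ x y → x + (D + y)) (pairs≡2edges G (apart-sym G ℓ)) (sym (sumF-swap shaved)) ⟩
      2 * N + (D + D)                     ≤⟨ +-monoʳ-≤ (2 * N) (+-mono-≤ D≤ D≤) ⟩
      2 * N + (6 * N + 6 * N)             ≡⟨ arith N ⟩
      2 * (7 * N) ∎)
      where
      open ≤-Reasoning
      surv : Fin n → Fin n → Bool
      surv = surviving contractCores
      surviving-sym : ∀ u v → surv u v ≡ surv v u
      surviving-sym u v = ≢ᵇ-sym _≟_ (merge contractCores u) (merge contractCores v)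
      shaved : Fin n → Fin n → ℕ
      shaved u v = if ⌊ core? G ℓ u ⌋ then 0 else ind (adj G u v)
      D : ℕ
      D = sumF (λ u → sumF (shaved u))
      D≤ : D ≤ 6 * N
      D≤ = ≤-trans (≤-reflexive (sumF-cong rows)) (sum-shavedDegree G ℓ)
        where
        rows : ∀ u → sumF (shaved u) ≡ shavedDegree G ℓ u
        rows u with core? G ℓ u
        ... | yes _ = sumF-0 n
        ... | no  _ = sym (count-ind (adj G u))
      arith : ∀ N → 2 * N + (6 * N + 6 * N) ≡ 2 * (7 * N)
      arith = solve-∀
      pointwise : ∀ u v → ind (adjAnd G surv u v) ≤ ind (adjAnd G (apart ℓ) u v) + (shaved u v + shaved v u)
      pointwise u v with adj G u v in uv
      ... | false = z≤n
      ... | true with core? G ℓ u | core? G ℓ v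
      ...   | no _   | _      = ≤-trans (ind≤1 (surv u v)) (≤-trans (m≤m+n 1 _) (m≤n+m _ (ind (apart ℓ u v))))
      ...   | yes _  | no _   rewrite adj-sym G v u | uv = ≤-trans (ind≤1 (surv u v)) (m≤n+m 1 (ind (apart ℓ u v)))
      ...   | yes cu | yes cv = ≤-trans (ind-mono (surv u v) (apart ℓ u v) λ h →
                fromWitnessFalse {a? = ℓ u ≟ᴸ ℓ v} λ ℓ≡ →
                  toWitnessFalse {a? = merge contractCores u ≟ merge contractCores v} h
                    (key-≡⇒merged u v (core-key-≡ G ℓ cu cv ℓ≡)))
              (m≤m+n _ 0)

    -- Each contracted vertex is charged 2δ at a representative. Core representatives belong to
    -- different classes, whose sizes sum to at most n; the remaining representatives are distinct
    -- and have total degree at most 6N.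
    size≤ : ∀ {δ} → (∀ v → δ ≤ degree G v) → 2 * (size contractCores * δ) ≤ 3 * n + 12 * N
    size≤ {δ} δ≤ = begin
      2 * (size contractCores * δ)        ≡⟨ arith₁ (size contractCores) δ ⟩
      size contractCores * (2 * δ)        ≡⟨ sumF-const (size contractCores) (2 * δ) ⟨
      sumF {size contractCores} (const (2 * δ))
        ≤⟨ sumF-mono (λ j → core-or-shaved G ℓ (rep j) (δ≤ (rep j))) ⟩
      sumF (λ j → 3 * inClass j + 2 * shavedDegree G ℓ (rep j))
        ≡⟨ trans (sumF-+ (λ j → 3 * inClass j) (λ j → 2 * shavedDegree G ℓ (rep j)))
                 (cong₂ _+_ (sumF-* 3 inClass) (sumF-* 2 (shavedDegree G ℓ ∘ rep))) ⟩
      3 * sumF inClass + 2 * sumF (shavedDegree G ℓ ∘ rep)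
        ≤⟨ +-mono-≤ (*-monoʳ-≤ 3 sum-inClass) (*-monoʳ-≤ 2 (≤-trans sum-reps (sum-shavedDegree G ℓ))) ⟩
      3 * n + 2 * (6 * N)                 ≡⟨ cong (3 * n +_) (sym (*-assoc 2 6 N)) ⟩
      3 * n + 12 * N                      ∎
      where
      open ≤-Reasoning
      arith₁ : ∀ s δ → 2 * (s * δ) ≡ s * (2 * δ)
      arith₁ = solve-∀
      rep : Fin (size contractCores) → Fin n
      rep j = proj₁ (onto contractCores j)
      merge-rep : ∀ j → merge contractCores (rep j) ≡ j
      merge-rep j = proj₂ (onto contractCores j) refl
      merged-reps : ∀ i j → merge contractCores (rep i) ≡ merge contractCores (rep j) → i ≡ j
      merged-reps i j eq = trans (sym (merge-rep i)) (trans eq (merge-rep j))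
      InClass : Fin (size contractCores) → Fin n → Bool
      InClass j = coreClass G ℓ (rep j)
      inClass : Fin (size contractCores) → ℕ
      inClass j = count (InClass j)
      sum-inClass : sumF inClass ≤ n
      sum-inClass = begin
        sumF inClass                              ≡⟨ sumF-cong (λ j → count-ind (InClass j)) ⟩
        sumF (λ j → sumF (λ v → ind (InClass j v))) ≤⟨ sumF-disjoint InClass (const 1) disjoint ⟩
        sumF {n} (const 1)                        ≡⟨ trans (sumF-const n 1) (*-identityʳ n) ⟩
        n                                         ∎
        where
        disjoint : ∀ i j v → T (InClass i v) → T (InClass j v) → i ≡ j
        disjoint i j v hi hj with ci , si ← to T-∧ hi | cj , sj ← to T-∧ hj =
          merged-reps i j (key-≡⇒merged (rep i) (rep j) (core-key-≡ G ℓ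
            (toWitness {a? = core? G ℓ (rep i)} ci) (toWitness {a? = core? G ℓ (rep j)} cj)
            (trans (toWitness {a? = ℓ (rep i) ≟ᴸ ℓ v} si) (sym (toWitness {a? = ℓ (rep j) ≟ᴸ ℓ v} sj)))))
      sum-reps : sumF (shavedDegree G ℓ ∘ rep) ≤ sumF (shavedDegree G ℓ)
      sum-reps = begin
        sumF (shavedDegree G ℓ ∘ rep)
          ≡⟨ sumF-cong (λ j → sym (sumF-single (rep j) (shavedDegree G ℓ))) ⟩
        sumF (λ j → sumF (λ v → if ⌊ v ≟ rep j ⌋ then shavedDegree G ℓ v else 0))
          ≤⟨ sumF-disjoint (λ j v → ⌊ v ≟ rep j ⌋) (shavedDegree G ℓ) (λ i j v hi hj →
               merged-reps i j (cong (merge contractCores)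
                 (trans (sym (toWitness {a? = v ≟ rep i} hi)) (toWitness {a? = v ≟ rep j} hj)))) ⟩
        sumF (shavedDegree G ℓ) ∎

    -- Distinct merged vertices are core vertices of one class. Each lies in the majority part of
    -- that class, since moving it there would otherwise give a smaller k-cut; so the cut does not
    -- separate them.
    contractCores-preserves : ∀ {δ} (S : KCut k G) → 0 < δ → (∀ v → δ ≤ degree G v) →
      NearlyConstant δ (part S) ℓ → IsMinKCut G S → Nontrivial S → Preserves contractCores S
    contractCores-preserves {δ} S 0<δ δ≤ near minimal nontrivial u v _ pu≢pv merged
      with key-≡ G ℓ u v (merged⇒key-≡ u v merged)
    ... | inj₁ u≡v = pu≢pv (cong (part S) u≡v)
    -- The outlier count depends on the vertex only through its label, so the same part `i` serves
    -- for `v`.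
    ... | inj₂ (cu , cv , ℓ≡) with i , few ← near u = pu≢pv (trans (in-majority u cu few)
            (sym (in-majority v cv (subst (λ x → 10 * count (λ w → ⌊ x ≟ᴸ ℓ w ⌋ ∧ not ⌊ part S w ≟ i ⌋) ≤ δ) ℓ≡ few))))
      where
      in-majority : ∀ {i} w → Core G ℓ w → 10 * outliers (part S) ℓ w i ≤ δ → part S w ≡ i
      in-majority {i} w cw few with part S w ≟ i
      ... | yes pw≡i = pw≡i
      ... | no  pw≢i = ⊥-elim (<⇒≱
        (move-decreases G (part S) w i (core-prefers-majority G ℓ (part S) w i 0<δ (δ≤ w) cw few pw≢i))
        (minimal (record { part = updateAt (part S) w (const i)
                         ; nonempty = move-surjective G (part S) w i (nonempty S) (nontrivial (part S w)) })))

  -- The bounds for α = a / b, with denominators cleared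

  sparsifier : ∀ a b {n} k (G : SimpleGraph n) δ → b ≤ a → 0 < δ → (∀ v → δ ≤ degree G v) →
    Σ (Contraction G) λ Ḡ →
      (∀ (S : KCut k G) → b * cutSize S ≤ a * δ → IsMinKCut G S → Nontrivial S → Preserves Ḡ S)
      × (b * (contractedEdges Ḡ * δ) ≤ 140 * a * numEdges G * (1 + logℕ n))
      × (b * (size Ḡ * δ * δ) ≤ 140 * a * numEdges G * (1 + logℕ n))
  -- `finToFun` enumerates all `k ^ n` maps into `Fin k`, and so every k-cut.
  sparsifier a b {n} k G δ b≤a 0<δ δ≤ = result (refine-by-light-cuts G a b δ (k ^ n) finToFun)
    where
    open ≤-Reasoning
    m L : ℕ
    m = numEdges G
    L = logℕ n

    result : (∃ λ (ℓ : Labelling) →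
        (b * edgesWhere G (apart ℓ) + 10 * a * potential ℓ ≤ 10 * a * (n * L)) ×
        (∀ j → b * edgesWhere G (cross (finToFun {k} {n} j)) ≤ a * δ → NearlyConstant δ (finToFun j) ℓ)) →
      Σ (Contraction G) λ Ḡ →
        (∀ (S : KCut k G) → b * cutSize S ≤ a * δ → IsMinKCut G S → Nontrivial S → Preserves Ḡ S)
        × (b * (contractedEdges Ḡ * δ) ≤ 140 * a * m * (1 + L))
        × (b * (size Ḡ * δ * δ) ≤ 140 * a * m * (1 + L))
    result (ℓ , inv , near) = Ḡ
      , (λ S light → contractCores-preserves G ℓ S 0<δ δ≤ (near-part S light))
      , edges-bound , *-cancelˡ-≤ 2 size-bound
      where
      Ḡ : Contraction G
      Ḡ = contractCores G ℓ
      N E s : ℕ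
      N = edgesWhere G (apart ℓ)
      E = contractedEdges Ḡ
      s = size Ḡ

      -- The enumerated copy of `part S` agrees with it only pointwise, so lightness and outlier
      -- counts are carried over inside the sums.
      near-part : ∀ (S : KCut k G) → b * cutSize S ≤ a * δ → NearlyConstant δ (part S) ℓ
      near-part S light u with near (funToFin (part S)) (≤-trans (*-monoʳ-≤ b (sumF-mono λ x → count-mono λ y →
             subst T (cong₂ (λ i j → (toℕ x <ᵇ toℕ y) ∧ adj G x y ∧ not ⌊ i ≟ j ⌋) (enum x) (enum y)))) light) u
        where
        enum : ∀ x → finToFun (funToFin (part S)) x ≡ part S x
        enum = finToFun-funToFin (part S)
      ... | i , few = i , ≤-trans (*-monoʳ-≤ 10 (count-mono λ v →
             subst T (cong (λ j → same ℓ u v ∧ not ⌊ j ≟ i ⌋) (sym (finToFun-funToFin (part S) v))))) few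

      bN≤ : b * N ≤ 10 * a * (n * L)
      bN≤ = ≤-trans (m≤m+n _ _) inv

      bNδ≤ : b * (N * δ) ≤ 20 * (a * m * L)
      bNδ≤ = begin
        b * (N * δ)                ≡⟨ *-assoc b N δ ⟨
        b * N * δ                  ≤⟨ *-monoˡ-≤ δ bN≤ ⟩
        10 * a * (n * L) * δ       ≡⟨ arith₁ a n L δ ⟩
        10 * a * L * (n * δ)       ≤⟨ *-monoʳ-≤ (10 * a * L) (minDegree-sum G δ≤) ⟩
        10 * a * L * (2 * m)       ≡⟨ arith₂ a L m ⟩
        20 * (a * m * L)           ∎
        where
        arith₁ : ∀ a n L δ → 10 * a * (n * L) * δ ≡ 10 * a * L * (n * δ)
        arith₁ = solve-∀
        arith₂ : ∀ a L m → 10 * a * L * (2 * m) ≡ 20 * (a * m * L)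
        arith₂ = solve-∀

      edges-bound : b * (E * δ) ≤ 140 * a * m * (1 + L)
      edges-bound = begin
        b * (E * δ)                ≤⟨ *-monoʳ-≤ b (*-monoˡ-≤ δ (contractedEdges≤ G ℓ)) ⟩
        b * (7 * N * δ)            ≡⟨ arith₁ b N δ ⟩
        7 * (b * (N * δ))          ≤⟨ *-monoʳ-≤ 7 bNδ≤ ⟩
        -- The constant 140 is this product 7 · 20; the vertex bound fits under it with room to
        -- spare.
        7 * (20 * (a * m * L))     ≡⟨ arith₂ a m L ⟩
        140 * a * m * L            ≤⟨ *-monoʳ-≤ (140 * a * m) (n≤1+n L) ⟩
        140 * a * m * (1 + L)      ∎
        where
        arith₁ : ∀ b N δ → b * (7 * N * δ) ≡ 7 * (b * (N * δ))
        arith₁ = solve-∀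
        arith₂ : ∀ a m L → 7 * (20 * (a * m * L)) ≡ 140 * a * m * L
        arith₂ = solve-∀

      size-bound : 2 * (b * (s * δ * δ)) ≤ 2 * (140 * a * m * (1 + L))
      size-bound = begin
        2 * (b * (s * δ * δ))                    ≡⟨ arith₁ b s δ ⟩
        b * δ * (2 * (s * δ))                    ≤⟨ *-monoʳ-≤ (b * δ) (size≤ G ℓ δ≤) ⟩
        b * δ * (3 * n + 12 * N)                 ≡⟨ arith₂ b δ n N ⟩
        -- Here α ≥ 1, in the form b ≤ a, absorbs the contribution of n.
        3 * (b * (n * δ)) + 12 * (b * (N * δ))   ≤⟨ +-mono-≤ (*-monoʳ-≤ 3 (*-mono-≤ b≤a (minDegree-sum G δ≤))) (*-monoʳ-≤ 12 bNδ≤) ⟩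
        -- The left side is 6am + 240amL, the target 280am + 280amL; the added term is their
        -- difference.
        3 * (a * (2 * m)) + 12 * (20 * (a * m * L)) ≤⟨ m≤m+n _ (274 * (a * m) + 40 * (a * m * L)) ⟩
        3 * (a * (2 * m)) + 12 * (20 * (a * m * L)) + (274 * (a * m) + 40 * (a * m * L)) ≡⟨ arith₃ a m L ⟩
        2 * (140 * a * m * (1 + L))              ∎
        where
        arith₁ : ∀ b s δ → 2 * (b * (s * δ * δ)) ≡ b * δ * (2 * (s * δ))
        arith₁ = solve-∀
        arith₂ : ∀ b δ n N → b * δ * (3 * n + 12 * N) ≡ 3 * (b * (n * δ)) + 12 * (b * (N * δ))
        arith₂ = solve-∀
        arith₃ : ∀ a m L → 3 * (a * (2 * m)) + 12 * (20 * (a * m * L)) + (274 * (a * m) + 40 * (a * m * L)) ≡ 2 * (140 * a * m * (1 + L))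
        arith₃ = solve-∀

open import Data.Rational using (ℚ; _≤_; _<_; _*_; 1ℚ)

import Data.Nat as ℕ
import Data.Nat.Properties as ℕₚ
open import Data.Integer using (+_; -[1+_])
import Data.Integer as ℤ
import Data.Integer.Properties as ℤₚ
open import Data.Rational using (mkℚ; *≤*; toℚᵘ; Positive; positive)
open import Data.Rational.Properties
open import Data.Rational.Unnormalised using (mkℚᵘ) renaming (_≃_ to _≃ᵘ_; *≡* to *≡*ᵘ; *≤* to *≤*ᵘ)
import Data.Rational.Unnormalised as ℚᵘ
import Data.Rational.Unnormalised.Properties as ℚᵘₚ
open import Relation.Binary.PropositionalEquality using (_≡_; refl; sym; trans; cong; subst; subst₂; module ≡-Reasoning)
open import Function using (_⇔_; mk⇔; Equivalence)
open import Data.Nat.Tactic.RingSolver using (solve-∀)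
open Equivalence using (to; from)

-- Transfer between natural and rational inequalities

-- `ℕ→ℚ` reduces to lowest terms by a gcd that is stuck on a variable; among unnormalised rationals
-- the value is plainly x / 1.
toℚᵘ-ℕ→ℚ : ∀ x → toℚᵘ (ℕ→ℚ x) ≃ᵘ mkℚᵘ (+ x) 0
toℚᵘ-ℕ→ℚ x = toℚᵘ-fromℚᵘ (mkℚᵘ (+ x) 0)

ℕ→ℚ-* : ∀ x y → ℕ→ℚ (x ℕ.* y) ≡ ℕ→ℚ x * ℕ→ℚ y
ℕ→ℚ-* x y = toℚᵘ-injective (begin-equality
  toℚᵘ (ℕ→ℚ (x ℕ.* y))               ≃⟨ toℚᵘ-ℕ→ℚ (x ℕ.* y) ⟩
  mkℚᵘ (+ (x ℕ.* y)) 0               ≡⟨ cong (λ z → mkℚᵘ z 0) (ℤₚ.pos-* x y) ⟩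
  mkℚᵘ (+ x) 0 ℚᵘ.* mkℚᵘ (+ y) 0     ≃⟨ ℚᵘₚ.*-cong (toℚᵘ-ℕ→ℚ x) (toℚᵘ-ℕ→ℚ y) ⟨
  toℚᵘ (ℕ→ℚ x) ℚᵘ.* toℚᵘ (ℕ→ℚ y)     ≃⟨ toℚᵘ-homo-* (ℕ→ℚ x) (ℕ→ℚ y) ⟨
  toℚᵘ (ℕ→ℚ x * ℕ→ℚ y)               ∎)
  where open ℚᵘₚ.≤-Reasoning

ℕ→ℚ-mono : ∀ {x y} → x ℕ.≤ y → ℕ→ℚ x ≤ ℕ→ℚ y
ℕ→ℚ-mono {x} {y} x≤y = toℚᵘ-cancel-≤ (begin
  toℚᵘ (ℕ→ℚ x)    ≃⟨ toℚᵘ-ℕ→ℚ x ⟩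
  mkℚᵘ (+ x) 0    ≤⟨ *≤*ᵘ (ℤₚ.*-monoʳ-≤-nonNeg (+ 1) (ℤ.+≤+ x≤y)) ⟩
  mkℚᵘ (+ y) 0    ≃⟨ toℚᵘ-ℕ→ℚ y ⟨
  toℚᵘ (ℕ→ℚ y)    ∎)
  where open ℚᵘₚ.≤-Reasoning

ℕ→ℚ-cancel-< : ∀ {x y} → ℕ→ℚ x < ℕ→ℚ y → x ℕ.< y
ℕ→ℚ-cancel-< x<y = ℕₚ.≰⇒> λ y≤x → <-irrefl refl (<-≤-trans x<y (ℕ→ℚ-mono y≤x))

ℕ→ℚ-strictMono : ∀ {x y} → x ℕ.< y → ℕ→ℚ x < ℕ→ℚ y
ℕ→ℚ-strictMono {x} {y} x<y = toℚᵘ-cancel-< (begin-strict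
  toℚᵘ (ℕ→ℚ x)    ≃⟨ toℚᵘ-ℕ→ℚ x ⟩
  mkℚᵘ (+ x) 0    <⟨ ℚᵘ.*<* (ℤₚ.*-monoʳ-<-pos (+ 1) (ℤ.+<+ x<y)) ⟩
  mkℚᵘ (+ y) 0    ≃⟨ toℚᵘ-ℕ→ℚ y ⟨
  toℚᵘ (ℕ→ℚ y)    ∎)
  where open ℚᵘₚ.≤-Reasoning

ℕ→ℚ-cancel : ∀ {x y} → ℕ→ℚ x ≤ ℕ→ℚ y → x ℕ.≤ y
ℕ→ℚ-cancel x≤y = ℕₚ.≮⇒≥ λ y<x → <-irrefl refl (<-≤-trans (ℕ→ℚ-strictMono y<x) x≤y)

-- The numerator and denominator of the reduced form serve as `a` and `b`; α ≥ 1 rules out a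
-- negative numerator and becomes b ≤ a.
fraction : ∀ α → 1ℚ ≤ α → ∃ λ a → ∃ λ b → 0 ℕ.< b × b ℕ.≤ a × α * ℕ→ℚ b ≡ ℕ→ℚ a
fraction α@(mkℚ -[1+ _ ] b-1 _) (*≤* ())
fraction α@(mkℚ (+ a) b-1 _) (*≤* b≤a) = a , suc b-1 , ℕ.s≤s ℕ.z≤n
  , ℤ.drop‿+≤+ (subst₂ ℤ._≤_ (ℤₚ.*-identityˡ (+ suc b-1)) (ℤₚ.*-identityʳ (+ a)) b≤a)
  , toℚᵘ-injective (begin-equality
      toℚᵘ (α * ℕ→ℚ (suc b-1))                  ≃⟨ toℚᵘ-homo-* α (ℕ→ℚ (suc b-1)) ⟩
      mkℚᵘ (+ a) b-1 ℚᵘ.* toℚᵘ (ℕ→ℚ (suc b-1))  ≃⟨ ℚᵘₚ.*-congˡ {mkℚᵘ (+ a) b-1} (toℚᵘ-ℕ→ℚ (suc b-1)) ⟩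
      mkℚᵘ (+ a) b-1 ℚᵘ.* mkℚᵘ (+ suc b-1) 0    ≃⟨ *≡*ᵘ eq ⟩
      mkℚᵘ (+ a) 0                              ≃⟨ toℚᵘ-ℕ→ℚ a ⟨
      toℚᵘ (ℕ→ℚ a)                              ∎)
  where
  open ℚᵘₚ.≤-Reasoning
  eq : (+ a ℤ.* + suc b-1) ℤ.* + 1 ≡ + a ℤ.* + suc (b-1 ℕ.* 1)
  eq rewrite ℕₚ.*-identityʳ b-1 = ℤₚ.*-identityʳ (+ a ℤ.* + suc b-1)

module _ {α : ℚ} {a b : ℕ} (0<b : 0 ℕ.< b) (αb≡a : α * ℕ→ℚ b ≡ ℕ→ℚ a) where
  private
    instance
      b-pos : Positive (ℕ→ℚ b)
      b-pos = positive (ℕ→ℚ-strictMono 0<b)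

    scale : ∀ y → α * ℕ→ℚ y * ℕ→ℚ b ≡ ℕ→ℚ (a ℕ.* y)
    scale y = begin
      α * ℕ→ℚ y * ℕ→ℚ b     ≡⟨ *-assoc α (ℕ→ℚ y) (ℕ→ℚ b) ⟩
      α * (ℕ→ℚ y * ℕ→ℚ b)   ≡⟨ cong (α *_) (*-comm (ℕ→ℚ y) (ℕ→ℚ b)) ⟩
      α * (ℕ→ℚ b * ℕ→ℚ y)   ≡⟨ *-assoc α (ℕ→ℚ b) (ℕ→ℚ y) ⟨
      α * ℕ→ℚ b * ℕ→ℚ y     ≡⟨ cong (_* ℕ→ℚ y) αb≡a ⟩
      ℕ→ℚ a * ℕ→ℚ y         ≡⟨ ℕ→ℚ-* a y ⟨
      ℕ→ℚ (a ℕ.* y)         ∎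
      where open ≡-Reasoning

    scale′ : ∀ x → ℕ→ℚ x * ℕ→ℚ b ≡ ℕ→ℚ (b ℕ.* x)
    scale′ x = trans (sym (ℕ→ℚ-* x b)) (cong ℕ→ℚ (ℕₚ.*-comm x b))

  -- Both sides are multiplied by the positive `b`. The forward direction translates lightness of a
  -- cut, the backward one the final bounds.
  clear-denominator : ∀ x y → ℕ→ℚ x ≤ α * ℕ→ℚ y ⇔ b ℕ.* x ℕ.≤ a ℕ.* y
  clear-denominator x y = mk⇔
    (λ x≤αy → ℕ→ℚ-cancel (subst₂ _≤_ (scale′ x) (scale y)
      (*-monoʳ-≤-nonNeg (ℕ→ℚ b) {{pos⇒nonNeg (ℕ→ℚ b)}} x≤αy)))
    (λ bx≤ay → *-cancelʳ-≤-pos (ℕ→ℚ b) (subst₂ _≤_ (sym (scale′ x)) (sym (scale y)) (ℕ→ℚ-mono bx≤ay)))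

collect : ∀ α c m l → ℕ→ℚ c * α * ℕ→ℚ m * ℕ→ℚ l ≡ α * ℕ→ℚ (c ℕ.* m ℕ.* l)
collect α c m l = begin
  ℕ→ℚ c * α * ℕ→ℚ m * ℕ→ℚ l     ≡⟨ cong (λ z → z * ℕ→ℚ m * ℕ→ℚ l) (*-comm (ℕ→ℚ c) α) ⟩
  α * ℕ→ℚ c * ℕ→ℚ m * ℕ→ℚ l     ≡⟨ cong (_* ℕ→ℚ l) (*-assoc α (ℕ→ℚ c) (ℕ→ℚ m)) ⟩
  α * (ℕ→ℚ c * ℕ→ℚ m) * ℕ→ℚ l   ≡⟨ *-assoc α (ℕ→ℚ c * ℕ→ℚ m) (ℕ→ℚ l) ⟩
  α * (ℕ→ℚ c * ℕ→ℚ m * ℕ→ℚ l)   ≡⟨ cong (λ z → α * (z * ℕ→ℚ l)) (ℕ→ℚ-* c m) ⟨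
  α * (ℕ→ℚ (c ℕ.* m) * ℕ→ℚ l)   ≡⟨ cong (α *_) (ℕ→ℚ-* (c ℕ.* m) l) ⟨
  α * ℕ→ℚ (c ℕ.* m ℕ.* l)       ∎
  where open ≡-Reasoning

theorem3p2 : ∃ λ (C : ℕ) → ∃ λ (c : ℕ) → ∃ λ (d : ℕ) →
    ∀ (α : ℚ) → 1ℚ ≤ α →
    ∀ (n k : ℕ) (G : SimpleGraph n) (δ : ℕ) → IsMinDegree G δ →
    ℕ→ℚ C * α * ℕ→ℚ (logℕ n) < ℕ→ℚ δ →
    ℕ→ℚ C * α * ℕ→ℚ k < ℕ→ℚ δ →
    Σ (Contraction G) λ Ḡ →
    ((∃ λ (S : KCut k G) → IsMinKCut G S × ℕ→ℚ (cutSize S) ≤ α * ℕ→ℚ δ) →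
    ∀ (S : KCut k G) → IsMinKCut G S → Nontrivial S → Preserves Ḡ S)
    × (ℕ→ℚ (contractedEdges Ḡ) * ℕ→ℚ δ
    ≤ ℕ→ℚ c * α * ℕ→ℚ (numEdges G) * ℕ→ℚ ((1 + logℕ n) ^ d))
    × (ℕ→ℚ (size Ḡ) * ℕ→ℚ δ * ℕ→ℚ δ
    ≤ ℕ→ℚ c * α * ℕ→ℚ (numEdges G) * ℕ→ℚ ((1 + logℕ n) ^ d))
-- With `C` = 0 the degree hypotheses read 0 < δ; 140 and the exponent 1 are those of `sparsifier`.
theorem3p2 = 0 , 140 , 1 , λ α 1≤α n k G δ (δ≤ , _) log-bound _ → construct α 1≤α n k G δ δ≤ log-bound
  where
  construct : ∀ α → 1ℚ ≤ α → ∀ n k (G : SimpleGraph n) δ → (∀ v → δ ℕ.≤ degree G v) →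
    ℕ→ℚ 0 * α * ℕ→ℚ (logℕ n) < ℕ→ℚ δ → Σ (Contraction G) λ Ḡ →
    ((∃ λ (S : KCut k G) → IsMinKCut G S × ℕ→ℚ (cutSize S) ≤ α * ℕ→ℚ δ) →
    ∀ (S : KCut k G) → IsMinKCut G S → Nontrivial S → Preserves Ḡ S)
    × (ℕ→ℚ (contractedEdges Ḡ) * ℕ→ℚ δ
    ≤ ℕ→ℚ 140 * α * ℕ→ℚ (numEdges G) * ℕ→ℚ ((1 + logℕ n) ^ 1))
    × (ℕ→ℚ (size Ḡ) * ℕ→ℚ δ * ℕ→ℚ δ
    ≤ ℕ→ℚ 140 * α * ℕ→ℚ (numEdges G) * ℕ→ℚ ((1 + logℕ n) ^ 1))
  construct α 1≤α n k G δ δ≤ log-bound =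
    let a , b , 0<b , b≤a , αb≡a = fraction α 1≤α
        cleared = clear-denominator {α} {a} {b} 0<b αb≡a
        Ḡ , preserves , edges , vertices = sparsifier a b k G δ b≤a 0<δ δ≤
    in Ḡ
     -- A minimum k-cut `S` is no larger than the given light cut `S₀`, hence light itself.
     , (λ (S₀ , minimal₀ , light₀) S minimal → preserves S
          (to (cleared (cutSize S) δ) (≤-trans (ℕ→ℚ-mono (minimal S₀)) light₀)) minimal)
     , bound {a} {b} cleared (contractedEdges Ḡ ℕ.* δ) (ℕ→ℚ-* (contractedEdges Ḡ) δ) edges
     , bound {a} {b} cleared (size Ḡ ℕ.* δ ℕ.* δ)
         (trans (ℕ→ℚ-* (size Ḡ ℕ.* δ) δ) (cong (_* ℕ→ℚ δ) (ℕ→ℚ-* (size Ḡ) δ))) vertices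
    where
    m L : ℕ
    m = numEdges G
    L = logℕ n

    0<δ : 0 ℕ.< δ
    0<δ = ℕ→ℚ-cancel-< (subst (_< ℕ→ℚ δ)
      (trans (cong (_* ℕ→ℚ L) (*-zeroˡ α)) (*-zeroˡ (ℕ→ℚ L))) log-bound)

    bound : ∀ {a b q} → (∀ x y → ℕ→ℚ x ≤ α * ℕ→ℚ y ⇔ b ℕ.* x ℕ.≤ a ℕ.* y) →
      ∀ x → ℕ→ℚ x ≡ q → b ℕ.* x ℕ.≤ 140 ℕ.* a ℕ.* m ℕ.* (1 + L) →
      q ≤ ℕ→ℚ 140 * α * ℕ→ℚ m * ℕ→ℚ ((1 + L) ^ 1)
    bound {a} {b} cleared x x≡q le = subst₂ _≤_ x≡q (sym (collect α 140 m ((1 + L) ^ 1)))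
      (from (cleared x (140 ℕ.* m ℕ.* (1 + L) ^ 1)) (subst (b ℕ.* x ℕ.≤_) regroup le))
      where
      regroup : 140 ℕ.* a ℕ.* m ℕ.* (1 + L) ≡ a ℕ.* (140 ℕ.* m ℕ.* (1 + L) ^ 1)
      regroup = trans (shuffle a m (1 + L))
        (cong (λ z → a ℕ.* (140 ℕ.* m ℕ.* z)) (sym (ℕₚ.*-identityʳ (1 + L))))
        where
        shuffle : ∀ a m l → 140 ℕ.* a ℕ.* m ℕ.* l ≡ a ℕ.* (140 ℕ.* m ℕ.* l)
        shuffle = solve-∀
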